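{- Let $s\ge 1$ be an integer. There exists an integer $M$, depending only on $s$, such that for all integers $L\ge 3$ and $k$ with $\max\{s+1,L\}\le k\le s+L$, and all integers $n\ge M$, \[ f_{L,s,k}(n)\ge c_{L,s,2}(n). \]
   Context: For positive integers $L,s,n$: $c_{L,s,2}(n)$ denotes the number of partitions of $n$ all of whose parts lie in $\{s+1,s+2,\ldots,s+L\}$. For positive integers $L,s,k,n$: $f_{L,s,k}(n)$ denotes the number of partitions of $n$ whose smallest part equals $s$, whose largest part is at most $L+s$, and which have no part equal to $k$. -}

module Defs where

open import Data.Nat using (ℕ; zero; suc; _+_; _≤_; _<_; _≤ᵇ_; _∸_; _≟_; _≤?_)
open import Data.List using (List; []; _∷_; map; concatMap; filter; filterᵇ; length; upTo)
open import Data.List.Relation.Unary.All as All using (All)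
open import Data.List.Relation.Unary.Any as Any using (Any)
open import Data.Product using (_×_)
open import Relation.Nullary using (¬_; Dec)
open import Relation.Nullary.Decidable using (_×-dec_; ¬?)
open import Relation.Unary using (Pred; Decidable)
open import Relation.Binary.PropositionalEquality using (_≡_)
open import Level using (0ℓ)

-- A partition is represented as a non-increasing list of positive parts.
-- boundedPartitions fuel n m : all partitions of n with every part ≤ m
-- (complete when fuel ≥ n), each listed exactly once as a
-- non-increasing list of positive integers.
boundedPartitions : ℕ → ℕ → ℕ → List (List ℕ)
boundedPartitions _          zero    _ = [] ∷ []
boundedPartitions zero       (suc _) _ = []
boundedPartitions (suc fuel) (suc n) m =
  concatMap (λ p → map (λ rest → p ∷ rest)
                       (boundedPartitions fuel (suc n ∸ p) p))
            (filterᵇ (λ p → p ≤ᵇ m) (map suc (upTo (suc n))))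

partitions : ℕ → List (List ℕ)
partitions n = boundedPartitions n n n

countPartitions : {P : Pred (List ℕ) 0ℓ} → Decidable P → ℕ → ℕ
countPartitions P? n = length (filter P? (partitions n))

SmallestPartIs : ℕ → List ℕ → Set
SmallestPartIs s π = Any (_≡ s) π × All (s ≤_) π

PartsIn : ℕ → ℕ → List ℕ → Set
PartsIn s L π = All (λ x → suc s ≤ x × x ≤ s + L) π

partsIn? : ∀ s L → Decidable (PartsIn s L)
partsIn? s L = All.all? (λ x → (suc s ≤? x) ×-dec (x ≤? s + L))

c₂ : ℕ → ℕ → ℕ → ℕ
c₂ L s n = countPartitions (partsIn? s L) n

FProp : ℕ → ℕ → ℕ → List ℕ → Set
FProp L s k π = SmallestPartIs s π × All (_≤ L + s) π × ¬ Any (_≡ k) π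

fProp? : ∀ L s k → Decidable (FProp L s k)
fProp? L s k π =
  ((Any.any? (_≟ s) π) ×-dec (All.all? (s ≤?_) π))
    ×-dec (All.all? (_≤? L + s) π)
    ×-dec ¬? (Any.any? (_≟ k) π)

f : ℕ → ℕ → ℕ → ℕ → ℕ
f L s k n = countPartitions (fProp? L s k) n

{-# OPTIONS --safe #-}
module Submission where

open import Defs
open import Data.Bool using (Bool; true; false; if_then_else_)
open import Data.List using (List; []; _∷_; map; concatMap; filter; filterᵇ; length; upTo; applyUpTo)
open import Data.List.Properties using (filter-++; length-++)
open import Data.List.Relation.Unary.All as All using (All)
open import Data.List.Relation.Unary.All.Properties using (¬Any⇒All¬; All¬⇒¬Any)
open import Data.List.Relation.Unary.Any as Any using (Any)
open import Data.Nat using (ℕ; zero; suc; _+_; _*_; _∸_; _⊔_; _≤_; _<_; z≤n; s≤s; _≤ᵇ_; _≟_; _≤?_; _<?_; NonZero; >-nonZero⁻¹)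
open import Data.Nat.DivMod using (_/_; _%_; m≡m%n+[m/n]*n; m%n<n; m*n/n≡m; /-monoˡ-≤)
open import Data.Nat.Induction using (<-rec)
open import Data.Nat.ListAction using (sum)
open import Data.Nat.Properties hiding (_≟_; _≤?_; _<?_)
open import Algebra.Properties.CommutativeSemigroup +-commutativeSemigroup using (interchange)
open import Data.Nat.Tactic.RingSolver using (solve-∀)
open import Data.Product using (Σ; _,_; _×_; proj₁; proj₂)
open import Data.Sum using (_⊎_; inj₁; inj₂)
open import Function using (_∘_; id; _⇔_; mk⇔; Equivalence)
open import Level using (0ℓ)
open import Relation.Binary.PropositionalEquality using (_≡_; _≢_; refl; sym; trans; cong; cong₂; subst; module ≡-Reasoning)
open import Relation.Nullary using (does; yes; no; contradiction)
open import Relation.Nullary.Decidable using (_×-dec_; ¬?; dec-true; dec-false; does-⇔)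
open import Relation.Unary using (Pred; Decidable)

-- Work with generating functions as coefficient sequences. Let A = {s+1, …, s+L} ∖ {k}. Partitions counted
-- by c₂ consist of copies of k and a partition with parts in A, those counted by f of at least one copy of s
-- and a partition with parts in A. First replace A by two of its elements p and p + u: (s+1, s+2), or (s+2, s+3)
-- if k = s+1, or (s+1, s+3) if k = s+2. For these, matching numbers of copies of k with numbers of copies of s
-- shows that the excess of the second count over the first tends to ∞ uniformly in k, since the number of partitions
-- into p and p + u is unbounded, is almost monotone, and grows by at most 1 when its argument grows by p.
-- Restoring the remaining parts of A multiplies by ∏ 1/(1 − qˣ); a small residue at which the excess is
-- negative is then paid for by trading in either one large part x or many copies of a small one, and each
-- large residue is charged only a bounded number of times, whatever the remaining parts are.

-- Coefficient sequences and multiplication by powers of q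

Series : Set
Series = ℕ → ℕ

one : Series
one zero    = 1
one (suc _) = 0

-- The coefficients of q^d times the series `g`.
shift : ℕ → Series → Series
shift zero    g n       = g n
shift (suc d) g zero    = 0
shift (suc d) g (suc n) = shift d g n

shift-+ : ∀ d g n → shift d g (d + n) ≡ g n
shift-+ zero    g n = refl
shift-+ (suc d) g n = shift-+ d g n

shift-< : ∀ {d n} g → n < d → shift d g n ≡ 0
shift-< {suc d} {zero}  g _         = refl
shift-< {suc d} {suc n} g (s≤s n<d) = shift-< g n<d

shift-shift : ∀ a b g n → shift a (shift b g) n ≡ shift (a + b) g n
shift-shift zero    b g n       = refl
shift-shift (suc a) b g zero    = refl
shift-shift (suc a) b g (suc n) = shift-shift a b g n

shift-comm : ∀ a b g n → shift a (shift b g) n ≡ shift b (shift a g) n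
shift-comm a b g n = trans (shift-shift a b g n)
  (trans (cong (λ d → shift d g n) (+-comm a b)) (sym (shift-shift b a g n)))

shift-cong : ∀ d {g h} → (∀ n → g n ≡ h n) → ∀ n → shift d g n ≡ shift d h n
shift-cong zero    g≡h n       = g≡h n
shift-cong (suc d) g≡h zero    = refl
shift-cong (suc d) g≡h (suc n) = shift-cong d g≡h n

shift-mono-≤ : ∀ d {g h} n → (∀ m → m ≤ n → g m ≤ h m) → shift d g n ≤ shift d h n
shift-mono-≤ zero    n       g≤h = g≤h n ≤-refl
shift-mono-≤ (suc d) zero    g≤h = z≤n
shift-mono-≤ (suc d) (suc n) g≤h = shift-mono-≤ d n (λ m m≤n → g≤h m (m≤n⇒m≤1+n m≤n))

shift-mono-< : ∀ d .{{_ : NonZero d}} {g h} n → (∀ {m} → m < n → g m ≤ h m) → shift d g n ≤ shift d h n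
shift-mono-< (suc d) zero    g≤h = z≤n
shift-mono-< (suc d) (suc n) g≤h = shift-mono-≤ d n (λ m m≤n → g≤h (s≤s m≤n))

shift-distrib-+ : ∀ d g h n → shift d (λ m → g m + h m) n ≡ shift d g n + shift d h n
shift-distrib-+ zero    g h n       = refl
shift-distrib-+ (suc d) g h zero    = refl
shift-distrib-+ (suc d) g h (suc n) = shift-distrib-+ d g h n

shift-distrib-* : ∀ d c g n → shift d (λ m → c * g m) n ≡ c * shift d g n
shift-distrib-* zero    c g n       = refl
shift-distrib-* (suc d) c g zero    = sym (*-zeroʳ c)
shift-distrib-* (suc d) c g (suc n) = shift-distrib-* d c g n

shift-bound : ∀ d {g} {c} → (∀ n → g n ≤ c) → ∀ n → shift d g n ≤ c
shift-bound zero    g≤c n       = g≤c n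
shift-bound (suc d) g≤c zero    = z≤n
shift-bound (suc d) g≤c (suc n) = shift-bound d g≤c n

-- The smaller shift reads `g` at an argument larger by `d`; where the larger shift runs off the
-- start, its value is 0.
shift-antitone : ∀ c d {g} → (∀ n → g n ≤ g (n + d)) → ∀ n → shift (c + d) g n ≤ shift c g n
shift-antitone (suc c) d     up zero    = z≤n
shift-antitone (suc c) d     up (suc n) = shift-antitone c d up n
shift-antitone zero    d {g} up n with n <? d
... | yes n<d = ≤-trans (≤-reflexive (shift-< g n<d)) z≤n
... | no  n≮d with m≤n⇒∃[o]m+o≡n (≮⇒≥ n≮d)
...   | o , refl = ≤-trans (≤-reflexive (shift-+ d g o)) (≤-trans (up o) (≤-reflexive (cong g (+-comm o d))))

-- Finite sums

sum< : ℕ → (ℕ → ℕ) → ℕ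
sum< zero    f = 0
sum< (suc n) f = f 0 + sum< n (f ∘ suc)

sum<-mono : ∀ n {f g} → (∀ i → i < n → f i ≤ g i) → sum< n f ≤ sum< n g
sum<-mono zero    f≤g = z≤n
sum<-mono (suc n) f≤g = +-mono-≤ (f≤g 0 (s≤s z≤n)) (sum<-mono n (λ i i<n → f≤g (suc i) (s≤s i<n)))

sum<-cong : ∀ n {f g} → (∀ i → f i ≡ g i) → sum< n f ≡ sum< n g
sum<-cong zero    f≡g = refl
sum<-cong (suc n) f≡g = cong₂ _+_ (f≡g 0) (sum<-cong n (f≡g ∘ suc))

sum<-zero : ∀ n {f} → (∀ i → f i ≡ 0) → sum< n f ≡ 0
sum<-zero zero    f≡0 = refl
sum<-zero (suc n) f≡0 = cong₂ _+_ (f≡0 0) (sum<-zero n (f≡0 ∘ suc))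

sum<-+ : ∀ a b f → sum< (a + b) f ≡ sum< a f + sum< b (λ i → f (a + i))
sum<-+ zero    b f = refl
sum<-+ (suc a) b f = trans (cong (f 0 +_) (sum<-+ a b (f ∘ suc))) (sym (+-assoc (f 0) _ _))

sum<-snoc : ∀ n f → sum< (suc n) f ≡ sum< n f + f n
sum<-snoc zero    f = +-identityʳ (f 0)
sum<-snoc (suc n) f = trans (cong (f 0 +_) (sum<-snoc n (f ∘ suc))) (sym (+-assoc (f 0) _ _))

sum<-add : ∀ n f g → sum< n (λ i → f i + g i) ≡ sum< n f + sum< n g
sum<-add zero    f g = refl
sum<-add (suc n) f g rewrite sum<-add n (f ∘ suc) (g ∘ suc) = interchange (f 0) (g 0) _ _

sum<-const : ∀ n c → sum< n (λ _ → c) ≡ n * c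
sum<-const zero    c = refl
sum<-const (suc n) c = cong (c +_) (sum<-const n c)

sum<-stable : ∀ {m n} f → m ≤ n → (∀ i → m ≤ i → f i ≡ 0) → sum< n f ≡ sum< m f
sum<-stable {m} f m≤n vanish with m≤n⇒∃[o]m+o≡n m≤n
... | o , refl = begin
  sum< (m + o) f                       ≡⟨ sum<-+ m o f ⟩
  sum< m f + sum< o (λ i → f (m + i))  ≡⟨ cong (sum< m f +_) (sum<-zero o (λ i → vanish (m + i) (m≤m+n m i))) ⟩
  sum< m f + 0                         ≡⟨ +-identityʳ _ ⟩
  sum< m f                             ∎
  where open ≡-Reasoning

shift-sum< : ∀ d N (f : ℕ → Series) n → shift d (λ m → sum< N (λ i → f i m)) n ≡ sum< N (λ i → shift d (f i) n)
shift-sum< zero    N f n       = refl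
shift-sum< (suc d) N f zero    = sym (sum<-zero N (λ _ → refl))
shift-sum< (suc d) N f (suc n) = shift-sum< d N f n

-- Geometric series

-- Division by 1 − qᵖ.
geo : ℕ → Series → Series
geo p g n = sum< (suc n) (λ t → shift (t * p) g n)

module _ (p : ℕ) .{{_ : NonZero p}} where

  shift-multiple-vanishes : ∀ g n t → n < t → shift (t * p) g n ≡ 0
  shift-multiple-vanishes g n t n<t = shift-< g (<-≤-trans n<t (m≤m*n t p))

  -- Terms beyond `n` vanish because `p` is positive, so sums for different arguments can share one
  -- range.
  geo-sum : ∀ g {n N} → n < N → geo p g n ≡ sum< N (λ t → shift (t * p) g n)
  geo-sum g {n} n<N = sym (sum<-stable _ n<N (shift-multiple-vanishes g n))

  -- Either no copy of `p` is used, or one copy is split off.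
  geo-unfold : ∀ g n → geo p g n ≡ g n + shift p (geo p g) n
  geo-unfold g n = cong (g n +_) (trans (sum<-cong n (λ t → sym (shift-shift p (t * p) g n))) tail)
    where
    tail : sum< n (λ t → shift p (shift (t * p) g) n) ≡ shift p (geo p g) n
    tail with n <? p
    ... | yes n<p = trans (sum<-zero n (λ t → shift-< (shift (t * p) g) n<p)) (sym (shift-< (geo p g) n<p))
    ... | no  n≮p with m≤n⇒∃[o]m+o≡n (≮⇒≥ n≮p)
    ...   | o , refl = begin
      sum< (p + o) (λ t → shift p (shift (t * p) g) (p + o))
        ≡⟨ sum<-cong (p + o) (λ t → shift-+ p (shift (t * p) g) o) ⟩
      sum< (p + o) (λ t → shift (t * p) g o)
        ≡⟨ geo-sum g (m<n+m o (>-nonZero⁻¹ p)) ⟨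
      geo p g o
        ≡⟨ shift-+ p (geo p g) o ⟨
      shift p (geo p g) (p + o) ∎
      where open ≡-Reasoning

  -- As `p` is positive, `shift p h n` only reads values below `n`, so strong induction reduces a
  -- comparison with `geo p g` to one step of the recurrence.
  geo-greatest : ∀ g h → (∀ n → h n ≤ g n + shift p h n) → ∀ n → h n ≤ geo p g n
  geo-greatest g h step = <-rec _ λ n ih → ≤-trans (step n)
    (≤-trans (+-monoʳ-≤ (g n) (shift-mono-< p n ih)) (≤-reflexive (sym (geo-unfold g n))))

  geo-least : ∀ g h → (∀ n → g n + shift p h n ≤ h n) → ∀ n → geo p g n ≤ h n
  geo-least g h step = <-rec _ λ n ih → ≤-trans (≤-reflexive (geo-unfold g n))
    (≤-trans (+-monoʳ-≤ (g n) (shift-mono-< p n ih)) (step n))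

  -- Source of the algebraic laws below: each is proved by checking that one side satisfies the
  -- recurrence of the other.
  geo-unique : ∀ g h → (∀ n → h n ≡ g n + shift p h n) → ∀ n → h n ≡ geo p g n
  geo-unique g h eq n = ≤-antisym (geo-greatest g h (λ m → ≤-reflexive (eq m)) n)
                                  (geo-least g h (λ m → ≤-reflexive (sym (eq m))) n)

  geo-mono : ∀ {g h} → (∀ n → g n ≤ h n) → ∀ n → geo p g n ≤ geo p h n
  geo-mono {g} {h} g≤h = geo-greatest h (geo p g) λ n →
    ≤-trans (≤-reflexive (geo-unfold g n)) (+-monoˡ-≤ _ (g≤h n))

  geo-cong : ∀ {g h} → (∀ n → g n ≡ h n) → ∀ n → geo p g n ≡ geo p h n
  geo-cong {g} {h} g≡h = geo-unique h (geo p g) λ n →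
    trans (geo-unfold g n) (cong (_+ _) (g≡h n))

  geo-distrib-+ : ∀ g h n → geo p (λ m → g m + h m) n ≡ geo p g n + geo p h n
  geo-distrib-+ g h n = sym (geo-unique _ (λ m → geo p g m + geo p h m) eq n)
    where
    eq : ∀ m → geo p g m + geo p h m ≡ g m + h m + shift p (λ l → geo p g l + geo p h l) m
    eq m = trans (cong₂ _+_ (geo-unfold g m) (geo-unfold h m))
      (trans (interchange (g m) _ (h m) _) (cong (g m + h m +_) (sym (shift-distrib-+ p _ _ m))))

  geo-distrib-* : ∀ c g n → geo p (λ m → c * g m) n ≡ c * geo p g n
  geo-distrib-* c g n = sym (geo-unique _ (λ m → c * geo p g m) eq n)
    where
    eq : ∀ m → c * geo p g m ≡ c * g m + shift p (λ l → c * geo p g l) m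
    eq m = trans (cong (c *_) (geo-unfold g m))
      (trans (*-distribˡ-+ c (g m) _) (cong (c * g m +_) (sym (shift-distrib-* p c _ m))))

  geo-shift : ∀ d g n → geo p (shift d g) n ≡ shift d (geo p g) n
  geo-shift d g n = sym (geo-unique _ (shift d (geo p g)) eq n)
    where
    eq : ∀ m → shift d (geo p g) m ≡ shift d g m + shift p (shift d (geo p g)) m
    eq m = trans (shift-cong d (geo-unfold g) m)
      (trans (shift-distrib-+ d g _ m) (cong (shift d g m +_) (shift-comm d p _ m)))

  geo-step : ∀ g n → geo p g n ≤ geo p g (n + p)
  geo-step g n = begin
    geo p g n                                      ≡⟨ shift-+ p (geo p g) n ⟨
    shift p (geo p g) (p + n)                      ≤⟨ m≤n+m _ _ ⟩
    g (p + n) + shift p (geo p g) (p + n)          ≡⟨ geo-unfold g (p + n) ⟨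
    geo p g (p + n)                                ≡⟨ cong (geo p g) (+-comm p n) ⟩
    geo p g (n + p)                                ∎
    where open ≤-Reasoning

  geo-one-≤1 : ∀ n → geo p one n ≤ 1
  geo-one-≤1 = geo-least one (λ _ → 1) step
    where
    step : ∀ n → one n + shift p (λ _ → 1) n ≤ 1
    step zero    = ≤-reflexive (cong suc (shift-< (λ _ → 1) (>-nonZero⁻¹ p)))
    step (suc n) = shift-bound p (λ _ → ≤-refl) (suc n)

geo-comm : ∀ p q .{{_ : NonZero p}} .{{_ : NonZero q}} g n → geo p (geo q g) n ≡ geo q (geo p g) n
geo-comm p q g n = sym (geo-unique p (geo q g) (geo q (geo p g)) eq n)
  where
  eq : ∀ m → geo q (geo p g) m ≡ geo q g m + shift p (geo q (geo p g)) m
  eq m = trans (geo-cong q (geo-unfold p g) m)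
    (trans (geo-distrib-+ q g _ m) (cong (geo q g m +_) (geo-shift q p (geo p g) m)))

-- Products of geometric series

-- Division by ∏ (1 − qˣ) over the x in {1, …, m} with q x = true.
mulParts : (ℕ → Bool) → ℕ → Series → Series
mulParts q zero    g = g
mulParts q (suc m) g = if q (suc m) then geo (suc m) (mulParts q m g) else mulParts q m g

mulParts-mono : ∀ q m {g h} → (∀ n → g n ≤ h n) → ∀ n → mulParts q m g n ≤ mulParts q m h n
mulParts-mono q zero    g≤h = g≤h
mulParts-mono q (suc m) g≤h with q (suc m)
... | true  = geo-mono (suc m) (mulParts-mono q m g≤h)
... | false = mulParts-mono q m g≤h

mulParts-distrib-+ : ∀ q m g h n →
  mulParts q m (λ l → g l + h l) n ≡ mulParts q m g n + mulParts q m h n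
mulParts-distrib-+ q zero    g h n = refl
mulParts-distrib-+ q (suc m) g h n with q (suc m)
... | true  = trans (geo-cong (suc m) (mulParts-distrib-+ q m g h) n) (geo-distrib-+ (suc m) (mulParts q m g) (mulParts q m h) n)
... | false = mulParts-distrib-+ q m g h n

mulParts-distrib-* : ∀ q m c g n → mulParts q m (λ l → c * g l) n ≡ c * mulParts q m g n
mulParts-distrib-* q zero    c g n = refl
mulParts-distrib-* q (suc m) c g n with q (suc m)
... | true  = trans (geo-cong (suc m) (mulParts-distrib-* q m c g) n) (geo-distrib-* (suc m) c _ n)
... | false = mulParts-distrib-* q m c g n

mulParts-shift : ∀ q m d g n → mulParts q m (shift d g) n ≡ shift d (mulParts q m g) n
mulParts-shift q zero    d g n = refl
mulParts-shift q (suc m) d g n with q (suc m)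
... | true  = trans (geo-cong (suc m) (mulParts-shift q m d g) n) (geo-shift (suc m) d _ n)
... | false = mulParts-shift q m d g n

mulParts-geo : ∀ q m p .{{_ : NonZero p}} g n → mulParts q m (geo p g) n ≡ geo p (mulParts q m g) n
mulParts-geo q zero    p g n = refl
mulParts-geo q (suc m) p g n with q (suc m)
... | true  = trans (geo-cong (suc m) (mulParts-geo q m p g) n) (geo-comm (suc m) p _ n)
... | false = mulParts-geo q m p g n

-- Partial sums and truncated comparison

geo-1-monotone : ∀ g {m n} → m ≤ n → geo 1 g m ≤ geo 1 g n
geo-1-monotone g {m} m≤n with m≤n⇒∃[o]m+o≡n m≤n
... | o , refl = go o
  where
  go : ∀ o → geo 1 g m ≤ geo 1 g (m + o)
  go zero    = ≤-reflexive (cong (geo 1 g) (sym (+-identityʳ m)))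
  go (suc o) = ≤-trans (go o) (≤-trans (geo-step 1 g (m + o))
    (≤-reflexive (cong (geo 1 g) (trans (+-assoc m o 1) (cong (m +_) (+-comm o 1))))))

-- `geo 1 g` is the sequence of partial sums of `g`, and `geo p g n` only sums some of those terms.
-- Monotonicity of the partial sums makes them a supersolution of the recurrence for `p`.
geo≤geo-1 : ∀ p .{{_ : NonZero p}} g n → geo p g n ≤ geo 1 g n
geo≤geo-1 (suc p) g = geo-least (suc p) g (geo 1 g) λ n → ≤-trans
  (+-monoʳ-≤ (g n) (shift-antitone 1 p (λ m → geo-1-monotone g (m≤m+n m p)) n))
  (≤-reflexive (sym (geo-unfold 1 g n)))

-- While at most `t` copies of `p` are removed, the argument is still at least `N` and the
-- hypothesis applies; all terms with more copies are kept in the last shift.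
geo-≤-truncated : ∀ p .{{_ : NonZero p}} N {g h} → (∀ n → N ≤ n → g n ≤ h n) →
  ∀ t n → N + t * p ≤ n → geo p g n ≤ geo p h n + shift (suc t * p) (geo p g) n
geo-≤-truncated p N {g} {h} g≤h zero n N≤n = begin
  geo p g n                                    ≡⟨ geo-unfold p g n ⟩
  g n + shift p (geo p g) n                    ≤⟨ +-monoˡ-≤ _ (g≤h n (≤-trans (m≤m+n N 0) N≤n)) ⟩
  h n + shift p (geo p g) n                    ≤⟨ +-monoˡ-≤ _ (m≤m+n (h n) _) ⟩
  h n + shift p (geo p h) n + shift p (geo p g) n ≡⟨ cong₂ _+_ (sym (geo-unfold p h n)) (cong (λ d → shift d (geo p g) n) (sym (+-identityʳ p))) ⟩
  geo p h n + shift (p + 0) (geo p g) n        ∎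
  where open ≤-Reasoning
geo-≤-truncated p N {g} {h} g≤h (suc t) n N≤n
  with m≤n⇒∃[o]m+o≡n (≤-trans (≤-trans (m≤m+n p (t * p)) (m≤n+m (p + t * p) N)) N≤n)
... | o , refl = begin
  geo p g (p + o)                              ≡⟨ geo-unfold p g (p + o) ⟩
  g (p + o) + shift p (geo p g) (p + o)        ≡⟨ cong (g (p + o) +_) (shift-+ p _ o) ⟩
  g (p + o) + geo p g o                        ≤⟨ +-mono-≤ (g≤h (p + o) (≤-trans (m≤m+n N _) N≤n)) (geo-≤-truncated p N g≤h t o N≤o) ⟩
  h (p + o) + (geo p h o + shift (suc t * p) (geo p g) o) ≡⟨ +-assoc (h (p + o)) _ _ ⟨
  h (p + o) + geo p h o + shift (suc t * p) (geo p g) o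
    ≡⟨ cong₂ (λ a b → h (p + o) + a + b) (sym (shift-+ p (geo p h) o))
         (trans (sym (shift-+ p (shift (suc t * p) (geo p g)) o)) (shift-shift p (suc t * p) (geo p g) (p + o))) ⟩
  h (p + o) + shift p (geo p h) (p + o) + shift (p + suc t * p) (geo p g) (p + o) ≡⟨ cong (_+ shift (p + suc t * p) (geo p g) (p + o)) (sym (geo-unfold p h (p + o))) ⟩
  geo p h (p + o) + shift (p + suc t * p) (geo p g) (p + o) ∎
  where
  open ≤-Reasoning
  rearrange : ∀ N p x → p + (N + x) ≡ N + (p + x)
  rearrange = solve-∀
  N≤o : N + t * p ≤ o
  N≤o = +-cancelˡ-≤ p (N + t * p) o (≤-trans (≤-reflexive (rearrange N p (t * p))) N≤n)

-- The polynomial 1 + q + ... + q^(N-1). It marks the residues at which the excess may be negative.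
below : ℕ → Series
below zero    _       = 0
below (suc N) zero    = 1
below (suc N) (suc n) = below N n

below-≥ : ∀ {N n} → N ≤ n → below N n ≡ 0
below-≥ {zero}          _         = refl
below-≥ {suc N} {suc n} (s≤s N≤n) = below-≥ N≤n

below-< : ∀ {N n} → n < N → below N n ≡ 1
below-< {suc N} {zero}  _         = refl
below-< {suc N} {suc n} (s≤s n<N) = below-< n<N

geo-1-below : ∀ N n → geo 1 (below N) n ≤ N
geo-1-below zero    n = ≤-reflexive (sum<-zero (suc n) (λ t → shift-zero (t * 1) n))
  where
  shift-zero : ∀ d n → shift d (below 0) n ≡ 0
  shift-zero zero    n       = refl
  shift-zero (suc d) zero    = refl
  shift-zero (suc d) (suc n) = shift-zero d n
geo-1-below (suc N) n = begin
  geo 1 (below (suc N)) n                        ≡⟨ geo-cong 1 decompose n ⟩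
  geo 1 (λ m → one m + shift 1 (below N) m) n    ≡⟨ geo-distrib-+ 1 one _ n ⟩
  geo 1 one n + geo 1 (shift 1 (below N)) n      ≡⟨ cong (geo 1 one n +_) (geo-shift 1 1 (below N) n) ⟩
  geo 1 one n + shift 1 (geo 1 (below N)) n      ≤⟨ +-mono-≤ (geo-one-≤1 1 n) (shift-bound 1 (geo-1-below N) n) ⟩
  suc N                                          ∎
  where
  open ≤-Reasoning
  decompose : ∀ m → below (suc N) m ≡ one m + shift 1 (below N) m
  decompose zero    = refl
  decompose (suc m) = refl

-- Trading small residues for blocks of parts

module Absorption (v N : ℕ) where

  -- A part x is traded away in blocks of 1 + extra x copies, of total size at least v.
  extra : ℕ → ℕ
  extra x with x <? v
  ... | yes _ = v
  ... | no  _ = 0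

  block : ℕ → ℕ
  block x = suc (extra x) * x

  v≤block : ∀ x → v ≤ block (suc x)
  v≤block x with suc x <? v
  ... | yes _   = ≤-trans (m≤m*n v (suc x)) (m≤n+m _ (suc x))
  ... | no  x≮v = ≤-trans (≮⇒≥ x≮v) (m≤m+n (suc x) 0)

  -- A residue below `N` is moved by one block of `x` into a window of length `N` starting at
  -- `block x`. All `x` up to `m` are included, so the series does not depend on which parts are
  -- adjoined.
  blocks : ℕ → Series
  blocks zero    n = 0
  blocks (suc m) n = blocks m n + shift (block (suc m)) (below N) n

  threshold : ℕ → ℕ
  threshold zero    = N
  threshold (suc m) = threshold m + extra (suc m) * suc m

  -- The threshold never decreases, and it is constant from `v` on because `extra` vanishes there.
  -- This makes the final bound independent of the largest part.
  threshold-bound : ∀ m → threshold m ≤ threshold v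
  threshold-bound m = ≤-trans (below-v m v) (≤-reflexive (trans (cong threshold (+-comm m v)) (above-v m)))
    where
    below-v : ∀ m d → threshold m ≤ threshold (m + d)
    below-v m zero    = ≤-reflexive (cong threshold (sym (+-identityʳ m)))
    below-v m (suc d) = ≤-trans (below-v m d) (≤-trans (m≤m+n _ _) (≤-reflexive (cong threshold (sym (+-suc m d)))))
    extra-large : ∀ x → v ≤ x → extra x ≡ 0
    extra-large x v≤x with x <? v
    ... | yes x<v = contradiction v≤x (<⇒≱ x<v)
    ... | no  _   = refl
    above-v : ∀ d → threshold (v + d) ≡ threshold v
    above-v zero    = cong threshold (+-identityʳ v)
    above-v (suc d) = trans (cong threshold (+-suc v d))
      (trans (cong (λ e → threshold (v + d) + e * suc (v + d)) (extra-large (suc (v + d)) (m≤n⇒m≤1+n (m≤m+n v d))))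
      (trans (+-identityʳ _) (above-v d)))

  blocks-small : ∀ m {n} → n < v → blocks m n ≡ 0
  blocks-small zero    n<v = refl
  blocks-small (suc m) n<v = cong₂ _+_ (blocks-small m n<v)
    (shift-< (below N) (<-≤-trans n<v (v≤block m)))

  -- Every block size is x or (1 + v) x, and either family meets a window of length N at most N times.
  blocks-bound : ∀ m n → blocks m n ≤ N + N
  blocks-bound m n = ≤-trans (split m) (+-mono-≤ (family 1 m) (family (suc v) m))
    where
    multiples : ℕ → ℕ → ℕ
    multiples c m = sum< m (λ x → shift (suc x * c) (below N) n)
    family : ∀ c .{{_ : NonZero c}} m → multiples c m ≤ N
    family c m = begin
      -- The term for zero copies and the terms beyond `m` complete the sum to `geo c (below N)`.
      multiples c m                                            ≤⟨ m≤n+m _ (below N n) ⟩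
      sum< (suc m) (λ x → shift (x * c) (below N) n)           ≤⟨ m≤m+n _ _ ⟩
      sum< (suc m) (λ x → shift (x * c) (below N) n) + _      ≡⟨ sum<-+ (suc m) (suc n) (λ x → shift (x * c) (below N) n) ⟨
      sum< (suc m + suc n) (λ x → shift (x * c) (below N) n)   ≡⟨ geo-sum c (below N) (m≤n+m (suc n) (suc m)) ⟨
      geo c (below N) n                                        ≤⟨ geo≤geo-1 c (below N) n ⟩
      geo 1 (below N) n                                        ≤⟨ geo-1-below N n ⟩
      N                                                        ∎
      where open ≤-Reasoning
    either : ∀ x → shift (block (suc x)) (below N) n ≤
      shift (suc x * 1) (below N) n + shift (suc x * suc v) (below N) n
    either x with suc x <? v
    ... | yes _ = ≤-trans (≤-reflexive (cong (λ d → shift d (below N) n) (*-comm (suc v) (suc x)))) (m≤n+m _ _)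
    ... | no  _ = ≤-trans (≤-reflexive (cong (λ d → shift d (below N) n) (*-comm 1 (suc x)))) (m≤m+n _ _)
    split : ∀ m → blocks m n ≤ multiples 1 m + multiples (suc v) m
    split zero    = z≤n
    split (suc m) = ≤-trans (+-mono-≤ (split m) (either m))
      (≤-reflexive (trans (interchange (multiples 1 m) (multiples (suc v) m) _ _)
        (cong₂ _+_ (sym (sum<-snoc m (λ x → shift (suc x * 1) (below N) n)))
                   (sym (sum<-snoc m (λ x → shift (suc x * suc v) (below N) n))))))

  -- Induction on the parts. With at most `extra p` copies of `p` removed, the argument stays above
  -- `threshold m` and the induction hypothesis applies; the terms with more copies contain a whole
  -- block and give the new summand of `blocks`.
  absorb : ∀ q m n → threshold m ≤ n → mulParts q m (below N) n ≤ mulParts q m (blocks m) n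
  absorb q zero    n N≤n = ≤-reflexive (below-≥ N≤n)
  absorb q (suc m) n t≤n with q (suc m)
  ... | false = ≤-trans (absorb q m n (≤-trans (m≤m+n _ _) t≤n))
                        (mulParts-mono q m (λ l → m≤m+n (blocks m l) _) n)
  ... | true = begin
    geo p (mulParts q m (below N)) n
      ≤⟨ geo-≤-truncated p (threshold m) (absorb q m) (extra p) n t≤n ⟩
    geo p (mulParts q m (blocks m)) n + shift (block p) (geo p (mulParts q m (below N))) n
      ≡⟨ cong (geo p (mulParts q m (blocks m)) n +_) (sym (trans (geo-cong p (mulParts-shift q m (block p) (below N)) n) (geo-shift p (block p) _ n))) ⟩
    geo p (mulParts q m (blocks m)) n + geo p (mulParts q m (shift (block p) (below N))) n
      ≡⟨ geo-distrib-+ p (mulParts q m (blocks m)) (mulParts q m (shift (block p) (below N))) n ⟨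
    geo p (λ l → mulParts q m (blocks m) l + mulParts q m (shift (block p) (below N)) l) n
      ≡⟨ geo-cong p (mulParts-distrib-+ q m (blocks m) _) n ⟨
    geo p (mulParts q m (blocks (suc m))) n ∎
    where
    open ≤-Reasoning
    p = suc m

-- Adjoining further parts

-- If F − G is eventually at least every constant, then adjoining further distinct parts
-- keeps it eventually nonnegative, with a bound independent of the parts adjoined.
module _ {I : Set} (G : I → Series) (F : Series) (bound : Series)
  (bound-mono : ∀ {m n} → m ≤ n → bound m ≤ bound n)
  (G≤bound : ∀ i n → G i n ≤ bound n)
  (dominates : ∀ K → Σ ℕ λ M → ∀ i n → M ≤ n → K + G i n ≤ F n) where

  mulParts-dominates : Σ ℕ λ M → ∀ i q m n → M ≤ n → mulParts q m (G i) n ≤ mulParts q m F n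
  mulParts-dominates = threshold v , result
    where
    -- From `N` on the excess is nonnegative, and below `N` the deficit is at most `K`. From `v` on
    -- the excess is at least `K * (N + N)`, the largest possible charge by `blocks-bound`.
    N = proj₁ (dominates 0)
    K = bound N
    v = N + proj₁ (dominates (K * (N + N)))
    open Absorption v N

    pointwise : ∀ i m n → G i n + K * blocks m n ≤ F n + K * below N n
    pointwise i m n with n <? N
    ... | yes n<N rewrite below-< n<N | blocks-small m (<-≤-trans n<N (m≤m+n N (proj₁ (dominates (K * (N + N)))))) = begin
      G i n + K * 0  ≡⟨ trans (cong (G i n +_) (*-zeroʳ K)) (+-identityʳ _) ⟩
      G i n          ≤⟨ G≤bound i n ⟩
      bound n        ≤⟨ bound-mono (<⇒≤ n<N) ⟩
      K              ≡⟨ *-identityʳ K ⟨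
      K * 1          ≤⟨ m≤n+m _ (F n) ⟩
      F n + K * 1    ∎
      where open ≤-Reasoning
    ... | no n≮N with n <? v
    ...   | yes n<v rewrite blocks-small m n<v = begin
      G i n + K * 0          ≡⟨ trans (cong (G i n +_) (*-zeroʳ K)) (+-identityʳ _) ⟩
      G i n                  ≤⟨ proj₂ (dominates 0) i n (≮⇒≥ n≮N) ⟩
      F n                    ≤⟨ m≤m+n (F n) _ ⟩
      F n + K * below N n    ∎
      where open ≤-Reasoning
    ...   | no n≮v = begin
      G i n + K * blocks m n  ≤⟨ +-monoʳ-≤ (G i n) (*-monoʳ-≤ K (blocks-bound m n)) ⟩
      G i n + K * (N + N)     ≡⟨ +-comm (G i n) _ ⟩
      K * (N + N) + G i n     ≤⟨ proj₂ (dominates (K * (N + N))) i n (≤-trans (m≤n+m _ N) (≮⇒≥ n≮v)) ⟩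
      F n                     ≤⟨ m≤m+n (F n) _ ⟩
      F n + K * below N n     ∎
      where open ≤-Reasoning

    result : ∀ i q m n → threshold v ≤ n → mulParts q m (G i) n ≤ mulParts q m F n
    -- The deficit term `K * below N` on the right is absorbed into `K * blocks m`, which then
    -- cancels against the same term on the left.
    result i q m n t≤n = +-cancelʳ-≤ (K * mulParts q m (blocks m) n) _ _ (begin
      mulParts q m (G i) n + K * mulParts q m (blocks m) n       ≡⟨ linear (G i) (blocks m) ⟨
      mulParts q m (λ l → G i l + K * blocks m l) n              ≤⟨ mulParts-mono q m (pointwise i m) n ⟩
      mulParts q m (λ l → F l + K * below N l) n                 ≡⟨ linear F (below N) ⟩
      mulParts q m F n + K * mulParts q m (below N) n            ≤⟨ +-monoʳ-≤ _ (*-monoʳ-≤ K (absorb q m n (≤-trans (threshold-bound m) t≤n))) ⟩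
      mulParts q m F n + K * mulParts q m (blocks m) n           ∎)
      where
      open ≤-Reasoning
      linear : ∀ g h → mulParts q m (λ l → g l + K * h l) n ≡ mulParts q m g n + K * mulParts q m h n
      linear g h = trans (mulParts-distrib-+ q m g _ n) (cong (mulParts q m g n +_) (mulParts-distrib-* q m K h n))

-- Partitions into the two parts p and p + u

Climbs : Series → ℕ → Set
Climbs g d = ∀ n → g n ≤ g (n + d)

climbs-+ : ∀ {g c d} → Climbs g c → Climbs g d → Climbs g (c + d)
climbs-+ {g} {c} {d} up-c up-d n =
  ≤-trans (≤-trans (up-c n) (up-d (n + c))) (≤-reflexive (cong g (+-assoc n c d)))

climbs-* : ∀ {g d} t → Climbs g d → Climbs g (t * d)
climbs-* {g} zero    up n = ≤-reflexive (cong g (sym (+-identityʳ n)))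
climbs-* {g} (suc t) up   = climbs-+ {g} up (climbs-* {g} t up)

module TwoParts (p₀ u₀ : ℕ) where

  p = suc p₀
  u = suc u₀

  pair : Series
  pair = geo p (geo (p + u) one)

  pair-climbs-p : Climbs pair p
  pair-climbs-p = geo-step p (geo (p + u) one)

  pair-climbs-p+u : Climbs pair (p + u)
  pair-climbs-p+u n = begin
    pair n                                  ≡⟨ geo-comm p (p + u) one n ⟩
    geo (p + u) (geo p one) n               ≤⟨ geo-step (p + u) (geo p one) n ⟩
    geo (p + u) (geo p one) (n + (p + u))   ≡⟨ geo-comm p (p + u) one (n + (p + u)) ⟨
    pair (n + (p + u))                      ∎
    where open ≤-Reasoning

  -- Writing x = a + b p with a < p ≤ b gives u x = (u b − a) p + a (p + u).
  pair-climbs : ∀ x → p * p ≤ x → Climbs pair (u * x)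
  pair-climbs x p²≤x = subst (Climbs pair) (sym u*x≡)
    (climbs-+ {pair} (climbs-* {pair} (d + u₀ * b) pair-climbs-p) (climbs-* {pair} a pair-climbs-p+u))
    where
    a = x % p
    b = x / p
    p≤b : p ≤ b
    p≤b = ≤-trans (≤-reflexive (sym (m*n/n≡m p p))) (/-monoˡ-≤ p p²≤x)
    a≤b : a ≤ b
    a≤b = ≤-trans (<⇒≤ (m%n<n x p)) p≤b
    d = proj₁ (m≤n⇒∃[o]m+o≡n a≤b)
    a+d≡b : a + d ≡ b
    a+d≡b = proj₂ (m≤n⇒∃[o]m+o≡n a≤b)
    ring : ∀ a d b p₀ u₀ → a + u₀ * a + ((a + d) + u₀ * b) * suc p₀ ≡ (d + u₀ * b) * suc p₀ + a * (suc p₀ + suc u₀)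
    ring = solve-∀
    expand : ∀ a b p₀ u₀ → suc u₀ * (a + b * suc p₀) ≡ a + u₀ * a + (b + u₀ * b) * suc p₀
    expand = solve-∀
    u*x≡ : u * x ≡ (d + u₀ * b) * p + a * (p + u)
    u*x≡ = trans (cong (u *_) (m≡m%n+[m/n]*n x p))
      (trans (expand a b p₀ u₀)
      (trans (cong (λ c → a + u₀ * a + (c + u₀ * b) * p) (sym a+d≡b)) (ring a d b p₀ u₀)))

  -- Passing from `n` to `n + p` adds only the representations without `p`, and there is at most one
  -- of these.
  pair-grows-slowly : ∀ t n → pair (n + t * p) ≤ t + pair n
  pair-grows-slowly zero    n = ≤-reflexive (cong pair (+-identityʳ n))
  pair-grows-slowly (suc t) n = begin
    pair (n + (p + t * p))                    ≡⟨ cong pair (rearrange n p (t * p)) ⟩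
    pair (p + (n + t * p))                    ≡⟨ geo-unfold p (geo (p + u) one) (p + (n + t * p)) ⟩
    geo (p + u) one (p + (n + t * p)) + shift p pair (p + (n + t * p))
                                              ≤⟨ +-mono-≤ (geo-one-≤1 (p + u) (p + (n + t * p))) (≤-reflexive (shift-+ p pair (n + t * p))) ⟩
    suc (pair (n + t * p))                    ≤⟨ s≤s (pair-grows-slowly t n) ⟩
    suc (t + pair n)                          ∎
    where
    open ≤-Reasoning
    rearrange : ∀ a b c → a + (b + c) ≡ b + (a + c)
    rearrange = solve-∀

  -- A positive multiple of `p * (p + u)` has a representation by copies of `p + u` alone. Those
  -- using `p` are at least as many as at the previous multiple, since what remains after one `p`
  -- exceeds it by a multiple of `p`.
  pair-unbounded : ∀ r → r ≤ pair (r * (p * (p + u)))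
  pair-unbounded zero    = z≤n
  pair-unbounded (suc r) = begin
    suc r                                           ≤⟨ +-mono-≤ multiple (≤-trans (pair-unbounded r) (climbs-* {pair} (p₀ + u) pair-climbs-p n)) ⟩
    geo (p + u) one (p + n′) + pair n′              ≡⟨ cong (geo (p + u) one (p + n′) +_) (shift-+ p pair n′) ⟨
    geo (p + u) one (p + n′) + shift p pair (p + n′) ≡⟨ geo-unfold p (geo (p + u) one) (p + n′) ⟨
    pair (p + n′)                                   ≡⟨ cong pair (total p₀ u r) ⟩
    pair (suc r * (p * (p + u)))                    ∎
    where
    open ≤-Reasoning
    n  = r * (p * (p + u))
    n′ = n + (p₀ + u) * p
    total : ∀ p₀ u r → suc p₀ + (r * (suc p₀ * (suc p₀ + u)) + (p₀ + u) * suc p₀) ≡ suc r * (suc p₀ * (suc p₀ + u))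
    total = solve-∀
    as-multiple : ∀ p₀ u r → suc r * (suc p₀ * (suc p₀ + u)) ≡ 0 + suc r * suc p₀ * (suc p₀ + u)
    as-multiple = solve-∀
    multiple : 1 ≤ geo (p + u) one (p + n′)
    multiple = ≤-trans (climbs-* {geo (p + u) one} (suc r * p) (geo-step (p + u) one) 0)
      (≤-reflexive (cong (geo (p + u) one) (sym (trans (total p₀ u r) (as-multiple p₀ u r)))))

  -- Matching copies of k with copies of s

  -- With k = s + u e, a copy count j of k is matched with j + u copies of s while j < J, at the cost
  -- of a bounded error, and with j + 2u copies of s from J on, without error.
  -- The u counts J + u, …, J + 2u − 1 of s that are left over outweigh the errors.
  module Matching (s₀ : ℕ)
    (leftover : ∀ r → Σ ℕ λ N → ∀ n → N ≤ n → r ≤ sum< u (λ l → shift (l * suc s₀) pair n)) where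

    s = suc s₀
    -- `R` is the threshold of `pair-climbs`. The summand `s + s` of `J` pays for the `2u`
    -- additional copies of `s` in `tail`; in `head`, `T * p` covers a loss of `u * s` and leaves
    -- room for two climbs of at least `u * R`.
    R = p * p
    J = R + (s + s)
    T = u * (R + R + s)

    -- The two exponents differ by `u * x` with `x` at least `R`, so the argument of `pair` grows by
    -- a climb and nothing is lost.
    tail : ∀ e n j → shift ((J + j) * (s + u * suc e)) pair n ≤ shift ((J + u + u + j) * s) pair n
    tail e n j = subst (λ d → shift d pair n ≤ shift ((J + u + u + j) * s) pair n)
      (sym (ring R s u j e)) (shift-antitone ((J + u + u + j) * s) (u * x) (pair-climbs x (m≤m+n R _)) n)
      where
      x = R + (j + (J + j) * e)
      ring : ∀ R s u j e → (R + (s + s) + j) * (s + u * suc e) ≡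
        (R + (s + s) + u + u + j) * s + u * (R + (j + (R + (s + s) + j) * e))
      ring = solve-∀

    -- Trading `j` copies of `k` for `j + u` copies of `s` changes the argument of `pair` from `w`
    -- to `m`, which may be smaller. Two climbs lead from `w` to `m + T * p`, and going back `T`
    -- steps of length `p` costs at most `T`.
    head : ∀ e n j → (j + u) * s ≤ n → shift (j * (s + u * suc e)) pair n ≤ T + shift ((u + j) * s) pair n
    head e n j js≤n with n <? j * (s + u * suc e)
    ... | yes n<jk = ≤-trans (≤-reflexive (shift-< pair n<jk)) z≤n
    ... | no  n≮jk with m≤n⇒∃[o]m+o≡n (≮⇒≥ n≮jk)
    ...   | w , refl with m≤n⇒∃[o]m+o≡n js≤n
    ...     | m , eq = begin
      shift (j * k) pair (j * k + w)               ≡⟨ shift-+ (j * k) pair w ⟩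
      pair w                                       ≤⟨ pair-climbs (R + j * suc e) (m≤m+n R _) w ⟩
      pair (w + u * (R + j * suc e))               ≤⟨ pair-climbs (R + (R + R + s) * p₀) (m≤m+n R _) (w + u * (R + j * suc e)) ⟩
      pair (w + u * (R + j * suc e) + u * (R + (R + R + s) * p₀)) ≡⟨ cong pair same ⟩
      pair (m + T * p)                             ≤⟨ pair-grows-slowly T m ⟩
      T + pair m                                   ≡⟨ cong (T +_) (shift-+ ((u + j) * s) pair m) ⟨
      T + shift ((u + j) * s) pair ((u + j) * s + m) ≡⟨ cong (λ a → T + shift ((u + j) * s) pair a) (trans (cong (λ a → a * s + m) (+-comm u j)) eq) ⟩
      T + shift ((u + j) * s) pair (j * k + w)     ∎
      where
      open ≤-Reasoning
      k = s + u * suc e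
      ring₁ : ∀ j s u e w R p₀ → (j + u) * s + (w + u * (R + j * suc e) + u * (R + (R + R + s) * p₀)) ≡
              j * (s + u * suc e) + w + u * (R + R + s) * suc p₀
      ring₁ = solve-∀
      same : w + u * (R + j * suc e) + u * (R + (R + R + s) * p₀) ≡ m + T * p
      same = +-cancelˡ-≡ ((j + u) * s) _ _ (trans (ring₁ j s u e w R p₀)
        (trans (cong (_+ T * p) (sym eq)) (+-assoc ((j + u) * s) m (T * p))))

    dominates : ∀ K → Σ ℕ λ M → ∀ e n → M ≤ n → K + geo (s + u * suc e) pair n ≤ shift s (geo s pair) n
    -- After `J + u` copies of `s` at least `N` remains, so the leftover terms outweigh `K` and the
    -- `J` errors of size `T`.
    dominates K = (J + u) * s + N , result
      where
      N = proj₁ (leftover (K + J * T))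
      result : ∀ e n → (J + u) * s + N ≤ n → K + geo (s + u * suc e) pair n ≤ shift s (geo s pair) n
      result e n M≤n = begin
        K + geo k pair n
          ≡⟨ cong (K +_) (geo-sum k pair (m≤n+m (suc n) J)) ⟩
        K + sum< (J + suc n) a
          ≡⟨ cong (K +_) (sum<-+ J (suc n) a) ⟩
        K + (sum< J a + sum< (suc n) (λ j → a (J + j)))
          ≤⟨ +-monoʳ-≤ K (+-mono-≤ heads (sum<-mono (suc n) (λ j _ → tail e n j))) ⟩
        K + (J * T + sum< J (λ j → b (u + j)) + sum< (suc n) (λ j → b (J + u + u + j)))
          ≡⟨ rearrange K (J * T) _ _ ⟩
        sum< J (λ j → b (u + j)) + (K + J * T) + sum< (suc n) (λ j → b (J + u + u + j))
          ≤⟨ +-monoˡ-≤ _ (+-monoʳ-≤ (sum< J (λ j → b (u + j))) middle) ⟩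
        sum< J (λ j → b (u + j)) + sum< u (λ l → b (J + u + l)) + sum< (suc n) (λ j → b (J + u + u + j))
          -- The unmatched counts 1, ..., `u₀` of `s` are added, so that all counts from 1 on form
          -- one range.
          ≤⟨ +-monoˡ-≤ _ (m≤n+m _ (sum< u₀ (b ∘ suc))) ⟩
        sum< u₀ (b ∘ suc) + (sum< J (λ j → b (u + j)) + sum< u (λ l → b (J + u + l))) + sum< (suc n) (λ j → b (J + u + u + j))
          ≡⟨ collect ⟩
        sum< (u₀ + J + u + suc n) (b ∘ suc)
          ≡⟨ sum<-cong (u₀ + J + u + suc n) (λ t → sym (shift-shift s (t * s) pair n)) ⟩
        sum< (u₀ + J + u + suc n) (λ t → shift s (shift (t * s) pair) n)
          ≡⟨ shift-sum< s (u₀ + J + u + suc n) (λ t → shift (t * s) pair) n ⟨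
        shift s (λ m → sum< (u₀ + J + u + suc n) (λ t → shift (t * s) pair m)) n
          ≤⟨ shift-mono-≤ s n (λ m m≤n → ≤-reflexive (sym (geo-sum s pair (≤-trans (s≤s m≤n) (m≤n+m (suc n) (u₀ + J + u)))))) ⟩
        shift s (geo s pair) n ∎
        where
        open ≤-Reasoning
        k = s + u * suc e
        a b : ℕ → ℕ
        a j = shift (j * k) pair n
        b i = shift (i * s) pair n
        rearrange : ∀ K JT h t → K + (JT + h + t) ≡ h + (K + JT) + t
        rearrange = solve-∀
        heads : sum< J a ≤ J * T + sum< J (λ j → b (u + j))
        heads = ≤-trans
          (sum<-mono J (λ j j<J → head e n j (≤-trans (*-monoˡ-≤ s (+-monoˡ-≤ u (<⇒≤ j<J))) (≤-trans (m≤m+n _ N) M≤n))))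
          (≤-reflexive (trans (sum<-add J (λ _ → T) (λ j → b (u + j))) (cong (_+ sum< J (λ j → b (u + j))) (sum<-const J T))))
        middle : K + J * T ≤ sum< u (λ l → b (J + u + l))
        middle with m≤n⇒∃[o]m+o≡n (≤-trans (m≤m+n ((J + u) * s) N) M≤n)
        ... | o , refl = ≤-trans (proj₂ (leftover (K + J * T)) o (+-cancelˡ-≤ ((J + u) * s) N o M≤n))
          (≤-reflexive (sum<-cong u λ l → trans (sym (shift-+ ((J + u) * s) (shift (l * s) pair) o))
            (trans (shift-shift ((J + u) * s) (l * s) pair ((J + u) * s + o))
                   (cong (λ d → shift d pair ((J + u) * s + o)) (sym (*-distribʳ-+ s (J + u) l))))))
        reindex : ∀ N x y → (∀ i → x + i ≡ y + i) → sum< N (λ i → b (x + i)) ≡ sum< N (λ i → b (y + i))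
        reindex N x y eq = sum<-cong N (λ i → cong b (eq i))
        collect : sum< u₀ (b ∘ suc) + (sum< J (λ j → b (u + j)) + sum< u (λ l → b (J + u + l))) + sum< (suc n) (λ j → b (J + u + u + j))
                ≡ sum< (u₀ + J + u + suc n) (b ∘ suc)
        collect = sym (trans (sum<-+ (u₀ + J + u) (suc n) (b ∘ suc)) (cong₂ _+_
          (trans (sum<-+ (u₀ + J) u (b ∘ suc)) (trans (cong₂ _+_ (sum<-+ u₀ J (b ∘ suc))
            (reindex u (suc (u₀ + J)) (J + u) (λ i → cong (_+ i) (+-comm u J)))) (+-assoc (sum< u₀ (b ∘ suc)) _ _)))
          (reindex (suc n) (suc (u₀ + J + u)) (J + u + u) (λ i → cong (λ c → c + u + i) (+-comm u J)))))

    -- `geo 1 pair` bounds `geo k pair` for all `k` at once, which keeps `M` independent of `e`.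
    adjoining-parts : Σ ℕ λ M → ∀ e q m n → M ≤ n →
      mulParts q m (geo (s + u * suc e) pair) n ≤ mulParts q m (shift s (geo s pair)) n
    adjoining-parts = mulParts-dominates (λ e → geo (s + u * suc e) pair) (shift s (geo s pair)) (geo 1 pair)
      (geo-1-monotone pair) (λ e → geo≤geo-1 (s + u * suc e) pair) dominates

-- Growth of the leftover terms

-- For `u = 1` the term `l = 0` suffices: every step of length at least `p * p` is a climb, so
-- `pair` stays above its value at `a`.
leftover-consecutive : ∀ p₀ s r → let open TwoParts p₀ 0 in
  Σ ℕ λ N → ∀ n → N ≤ n → r ≤ sum< 1 (λ l → shift (l * s) pair n)
leftover-consecutive p₀ s r = a + p * p , result
  where
  open TwoParts p₀ 0
  a = r * (p * (p + 1))
  result : ∀ n → a + p * p ≤ n → r ≤ pair n + 0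
  result n N≤n with m≤n⇒∃[o]m+o≡n (≤-trans (m≤m+n a (p * p)) N≤n)
  ... | o , refl = begin
    r                    ≤⟨ pair-unbounded r ⟩
    pair a               ≤⟨ pair-climbs o (+-cancelˡ-≤ a (p * p) o N≤n) a ⟩
    pair (a + 1 * o)     ≡⟨ cong (λ b → pair (a + b)) (*-identityˡ o) ⟩
    pair (a + o)         ≤⟨ m≤m+n _ 0 ⟩
    pair (a + o) + 0     ∎
    where open ≤-Reasoning

halve : ∀ n → (Σ ℕ λ m → n ≡ 2 * m) ⊎ (Σ ℕ λ m → n ≡ suc (2 * m))
halve zero    = inj₁ (0 , refl)
halve (suc n) with halve n
... | inj₁ (m , refl) = inj₂ (m , refl)
... | inj₂ (m , refl) = inj₁ (suc m , cong suc (sym (+-suc m (m + 0))))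

-- The parts s + 1 and s + 3 reach every large even number, and one of s and s + 1 is odd.
leftover-gap : ∀ s r → let open TwoParts s 1 in
  Σ ℕ λ N → ∀ n → N ≤ n → r ≤ sum< 2 (λ l → shift (l * s) pair n)
-- The summand `s` leaves an even remainder of at least `2 * (p * p)` beyond `a` when an odd `p` or
-- `s` is removed to correct the parity.
leftover-gap s r = a + 2 * (p * p + s) , result
  where
  open TwoParts s 1
  a = 2 * r * (p * (p + 2))
  large : ∀ x → p * p ≤ x → r ≤ pair (a + 2 * x)
  large x p²≤x = begin
    r                 ≤⟨ m≤m+n r (r + 0) ⟩
    2 * r             ≤⟨ pair-unbounded (2 * r) ⟩
    pair a            ≤⟨ pair-climbs x p²≤x a ⟩
    pair (a + 2 * x)  ∎
    where open ≤-Reasoning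
  half-bound : ∀ {x y} → 2 * x ≤ suc (2 * y) → x ≤ y
  half-bound {x} {y} le = ≮⇒≥ λ y<x → 1+n≰n (≤-trans (≤-trans (s≤s le) (≤-reflexive (double y))) (*-monoʳ-≤ 2 y<x))
    where
    double : ∀ y → 2 + 2 * y ≡ 2 * suc y
    double = solve-∀
  result : ∀ n → a + 2 * (p * p + s) ≤ n → r ≤ pair n + (shift (1 * s) pair n + 0)
  result n N≤n with m≤n⇒∃[o]m+o≡n (≤-trans (m≤m+n a (2 * (p * p + s))) N≤n)
  ... | o , refl with halve o | +-cancelˡ-≤ a (2 * (p * p + s)) o N≤n
  ...   | inj₁ (x , refl) | le = ≤-trans (large x (≤-trans (m≤m+n (p * p) s) (*-cancelˡ-≤ 2 le))) (m≤m+n _ _)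
  ...   | inj₂ (x , refl) | le with m≤n⇒∃[o]m+o≡n (≤-trans (m≤n+m s (p * p)) (half-bound {p * p + s} {x} le)) | halve s
  -- For even `s` the part `p = s + 1` is odd, and one copy of it corrects the parity within `pair`.
  ...     | y , refl | inj₁ (h , s≡2h) = begin
    r                                  ≤⟨ large (h + y) (≤-trans p²≤y (m≤n+m y h)) ⟩
    pair (a + 2 * (h + y))             ≤⟨ pair-climbs-p (a + 2 * (h + y)) ⟩
    pair (a + 2 * (h + y) + p)         ≡⟨ cong pair total ⟩
    pair (a + suc (2 * (s + y)))       ≤⟨ m≤m+n _ _ ⟩
    pair (a + suc (2 * (s + y))) + _   ∎
    where
    open ≤-Reasoning
    p²≤y : p * p ≤ y
    p²≤y = +-cancelʳ-≤ s (p * p) y (≤-trans (half-bound {p * p + s} {s + y} le) (≤-reflexive (+-comm s y)))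
    ring : ∀ a h y → a + 2 * (h + y) + suc (2 * h) ≡ a + suc (2 * (2 * h + y))
    ring = solve-∀
    total : a + 2 * (h + y) + p ≡ a + suc (2 * (s + y))
    total = trans (cong (λ c → a + 2 * (h + y) + suc c) s≡2h)
      (trans (ring a h y) (cong (λ c → a + suc (2 * (c + y))) (sym s≡2h)))
  -- For odd `s` the term `l = 1`, with one copy of `s`, corrects the parity.
  ...     | y , refl | inj₂ (h , s≡1+2h) = begin
    r                                                   ≤⟨ large (suc h + y) (≤-trans p²≤y (m≤n+m y (suc h))) ⟩
    pair (a + 2 * (suc h + y))                          ≡⟨ shift-+ (1 * s) pair _ ⟨
    shift (1 * s) pair (1 * s + (a + 2 * (suc h + y)))  ≡⟨ cong (shift (1 * s) pair) total ⟩
    shift (1 * s) pair (a + suc (2 * (s + y)))          ≤⟨ m≤m+n _ 0 ⟩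
    shift (1 * s) pair (a + suc (2 * (s + y))) + 0      ≤⟨ m≤n+m _ (pair (a + suc (2 * (s + y)))) ⟩
    pair (a + suc (2 * (s + y))) + (shift (1 * s) pair (a + suc (2 * (s + y))) + 0) ∎
    where
    open ≤-Reasoning
    p²≤y : p * p ≤ y
    p²≤y = +-cancelʳ-≤ s (p * p) y (≤-trans (half-bound {p * p + s} {s + y} le) (≤-reflexive (+-comm s y)))
    ring : ∀ a h y → 1 * suc (2 * h) + (a + 2 * (suc h + y)) ≡ a + suc (2 * (suc (2 * h) + y))
    ring = solve-∀
    total : 1 * s + (a + 2 * (suc h + y)) ≡ a + suc (2 * (s + y))
    total = trans (cong (λ c → 1 * c + (a + 2 * (suc h + y))) s≡1+2h)
      (trans (ring a h y) (cong (λ c → a + suc (2 * (c + y))) (sym s≡1+2h)))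

-- From lists of partitions to series

count : {P : Pred (List ℕ) 0ℓ} → Decidable P → List (List ℕ) → ℕ
count P? xs = length (filter P? xs)

count-concatMap : ∀ {P : Pred (List ℕ) 0ℓ} (P? : Decidable P) (h : ℕ → List (List ℕ)) ps →
  count P? (concatMap h ps) ≡ sum (map (count P? ∘ h) ps)
count-concatMap P? h []       = refl
count-concatMap P? h (p ∷ ps) = trans (cong length (filter-++ P? (h p) (concatMap h ps)))
  (trans (length-++ (filter P? (h p))) (cong (count P? (h p) +_) (count-concatMap P? h ps)))

count-⊆-∪ : ∀ {P Q R : Pred (List ℕ) 0ℓ} (P? : Decidable P) (Q? : Decidable Q) (R? : Decidable R) →
  (∀ {π} → P π → Q π ⊎ R π) → ∀ xs → count P? xs ≤ count Q? xs + count R? xs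
count-⊆-∪ P? Q? R? cover []       = z≤n
count-⊆-∪ P? Q? R? cover (π ∷ xs) with count-⊆-∪ P? Q? R? cover xs | P? π | Q? π | R? π
... | ih | no  _ | no  _ | no  _ = ih
... | ih | no  _ | no  _ | yes _ = ≤-trans ih (+-monoʳ-≤ (count Q? xs) (n≤1+n _))
... | ih | no  _ | yes _ | no  _ = m≤n⇒m≤1+n ih
... | ih | no  _ | yes _ | yes _ = m≤n⇒m≤1+n (≤-trans ih (+-monoʳ-≤ (count Q? xs) (n≤1+n _)))
... | ih | yes _ | yes _ | no  _ = s≤s ih
... | ih | yes _ | yes _ | yes _ = s≤s (≤-trans ih (+-monoʳ-≤ (count Q? xs) (n≤1+n _)))
... | ih | yes _ | no  _ | yes _ = ≤-trans (s≤s ih) (≤-reflexive (sym (+-suc (count Q? xs) _)))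
... | ih | yes a | no ¬b | no ¬c with cover a
...   | inj₁ b = contradiction b ¬b
...   | inj₂ c = contradiction c ¬c

sum-filter-applyUpTo : ∀ (φ : ℕ → ℕ) (P : ℕ → Bool) f N →
  sum (map φ (filterᵇ P (map suc (applyUpTo f N)))) ≡ sum< N (λ i → if P (suc (f i)) then φ (suc (f i)) else 0)
sum-filter-applyUpTo φ P f zero    = refl
sum-filter-applyUpTo φ P f (suc N) with P (suc (f 0))
... | true  = cong (φ (suc (f 0)) +_) (sum-filter-applyUpTo φ P (f ∘ suc) N)
... | false = sum-filter-applyUpTo φ P (f ∘ suc) N

-- Both sides sum `ψ` over the indices below the minimum of `N` and `m`.
sum<-restrict : ∀ N m (ψ : ℕ → ℕ) →
  sum< N (λ i → if suc i ≤ᵇ m then ψ i else 0) ≡ sum< m (λ i → if suc i ≤ᵇ N then ψ i else 0)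
sum<-restrict zero    m       ψ = sym (sum<-zero m (λ _ → refl))
sum<-restrict (suc N) zero    ψ = sum<-zero (suc N) (λ _ → refl)
sum<-restrict (suc N) (suc m) ψ = cong (ψ 0 +_) (sum<-restrict N m (ψ ∘ suc))

-- A part larger than `n` cannot contribute to the coefficient at `n`.
mulParts-stable : ∀ q d g n → mulParts q (d + n) g n ≡ mulParts q n g n
mulParts-stable q zero    g n = refl
mulParts-stable q (suc d) g n with q (suc (d + n))
... | false = mulParts-stable q d g n
... | true  = begin
  geo (suc (d + n)) h n                         ≡⟨ geo-unfold (suc (d + n)) h n ⟩
  h n + shift (suc (d + n)) (geo (suc (d + n)) h) n ≡⟨ cong (h n +_) (shift-< (geo (suc (d + n)) h) (s≤s (m≤n+m n d))) ⟩
  h n + 0                                       ≡⟨ +-identityʳ (h n) ⟩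
  h n                                           ≡⟨ mulParts-stable q d g n ⟩
  mulParts q n g n                              ∎
  where
  open ≡-Reasoning
  h = mulParts q (d + n) g

mulParts-at-0 : ∀ q m g → mulParts q m g 0 ≡ g 0
mulParts-at-0 q m g = trans (cong (λ l → mulParts q l g 0) (sym (+-identityʳ m))) (mulParts-stable q m g 0)

-- Classification by the largest part `suc i`, in the shape of the recursion of `boundedPartitions`.
-- The argument is positive because the empty partition has no largest part.
mulParts-by-largest : ∀ q m n → mulParts q m one (suc n) ≡
  sum< m (λ i → if q (suc i) then shift (suc i) (mulParts q (suc i) one) (suc n) else 0)
mulParts-by-largest q zero    n = refl
mulParts-by-largest q (suc m) n = trans step
  (sym (sum<-snoc m (λ i → if q (suc i) then shift (suc i) (mulParts q (suc i) one) (suc n) else 0)))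
  where
  step : mulParts q (suc m) one (suc n) ≡
    sum< m (λ i → if q (suc i) then shift (suc i) (mulParts q (suc i) one) (suc n) else 0)
      + (if q (suc m) then shift (suc m) (mulParts q (suc m) one) (suc n) else 0)
  step with q (suc m)
  ... | false = trans (mulParts-by-largest q m n) (sym (+-identityʳ _))
  ... | true  = trans (geo-unfold (suc m) (mulParts q m one) (suc n))
                      (cong (_+ shift (suc m) (geo (suc m) (mulParts q m one)) (suc n)) (mulParts-by-largest q m n))

module _ {Q : Pred ℕ 0ℓ} (Q? : Decidable Q) where

  private
    q : ℕ → Bool
    q x = does (Q? x)

  count-cons : ∀ p xs → count (All.all? Q?) (map (p ∷_) xs) ≡ (if q p then count (All.all? Q?) xs else 0)
  count-cons p []       = sym (if-same (q p))
    where
    if-same : ∀ b → (if b then 0 else 0) ≡ 0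
    if-same true  = refl
    if-same false = refl
  count-cons p (π ∷ xs) with ih ← count-cons p xs | does (Q? p) | does (All.all? Q? π)
  ... | false | _     = ih
  ... | true  | true  = cong suc ih
  ... | true  | false = ih

  count-boundedPartitions : ∀ fuel n m → n ≤ fuel →
    count (All.all? Q?) (boundedPartitions fuel n m) ≡ mulParts q m one n
  count-boundedPartitions zero       zero    m _ = sym (mulParts-at-0 q m one)
  count-boundedPartitions (suc fuel) zero    m _ = sym (mulParts-at-0 q m one)
  count-boundedPartitions (suc fuel) (suc n) m (s≤s n≤fuel) = begin
    count (All.all? Q?) (boundedPartitions (suc fuel) (suc n) m)
      ≡⟨ count-concatMap (All.all? Q?) with-largest (filterᵇ (λ p → p ≤ᵇ m) (map suc (upTo (suc n)))) ⟩
    sum (map φ (filterᵇ (λ p → p ≤ᵇ m) (map suc (upTo (suc n)))))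
      ≡⟨ sum-filter-applyUpTo φ (λ p → p ≤ᵇ m) id (suc n) ⟩
    sum< (suc n) (λ i → if suc i ≤ᵇ m then φ (suc i) else 0)
      ≡⟨ sum<-restrict (suc n) m (φ ∘ suc) ⟩
    sum< m (λ i → if suc i ≤ᵇ suc n then φ (suc i) else 0)
      ≡⟨ sum<-cong m term ⟩
    sum< m (λ i → if q (suc i) then shift (suc i) (mulParts q (suc i) one) (suc n) else 0)
      ≡⟨ mulParts-by-largest q m n ⟨
    mulParts q m one (suc n) ∎
    where
    open ≡-Reasoning
    with-largest : ℕ → List (List ℕ)
    with-largest p = map (p ∷_) (boundedPartitions fuel (suc n ∸ p) p)
    φ : ℕ → ℕ
    φ p = count (All.all? Q?) (with-largest p)
    if-zero : ∀ b {x} → x ≡ 0 → 0 ≡ (if b then x else 0)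
    if-zero true  x≡0 = sym x≡0
    if-zero false _   = refl
    term : ∀ i → (if suc i ≤ᵇ suc n then φ (suc i) else 0) ≡
                 (if q (suc i) then shift (suc i) (mulParts q (suc i) one) (suc n) else 0)
    term i with suc i ≤? suc n
    -- A part exceeding the total is excluded by the test on the left and gives a vanishing shift on
    -- the right.
    ... | no  i≰n rewrite dec-false (suc i ≤? suc n) i≰n = if-zero (q (suc i)) (shift-< (mulParts q (suc i) one) (≰⇒> i≰n))
    ... | yes i≤n rewrite dec-true (suc i ≤? suc n) i≤n = trans (count-cons (suc i) (boundedPartitions fuel (n ∸ i) (suc i)))
      (cong (λ x → if q (suc i) then x else 0) (trans
        (count-boundedPartitions fuel (n ∸ i) (suc i) (≤-trans (m∸n≤m n i) n≤fuel))
        (trans (sym (shift-+ i (mulParts q (suc i) one) (n ∸ i)))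
               (cong (shift i (mulParts q (suc i) one)) (m+[n∸m]≡n (≤-pred i≤n))))))

  -- The slack `d` lets the range of parts reach `s + L` even when `n` is smaller, so a part can be
  -- extracted whatever `n` is.
  countPartitions-all : ∀ d n → countPartitions (All.all? Q?) n ≡ mulParts q (d + n) one n
  countPartitions-all d n = trans (count-boundedPartitions n n n ≤-refl) (sym (mulParts-stable q d one n))

-- Extracting one part from the product

mulParts-ext : ∀ {q q′} m → (∀ x → x ≤ m → q x ≡ q′ x) → ∀ g → mulParts q m g ≡ mulParts q′ m g
mulParts-ext zero    q≡q′ g = refl
mulParts-ext {q} {q′} (suc m) q≡q′ g
  rewrite q≡q′ (suc m) ≤-refl | mulParts-ext {q} {q′} m (λ x x≤m → q≡q′ x (m≤n⇒m≤1+n x≤m)) g = refl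

-- The factor of `a` is moved outwards past the factors of the larger parts, with which it commutes.
mulParts-extract : ∀ {Q Q′ : Pred ℕ 0ℓ} (Q? : Decidable Q) (Q′? : Decidable Q′) a .{{_ : NonZero a}} →
  Q a → (∀ x → Q′ x ⇔ (Q x × x ≢ a)) → ∀ m → a ≤ m →
  ∀ g n → mulParts (λ x → does (Q? x)) m g n ≡ geo a (mulParts (λ x → does (Q′? x)) m g) n
mulParts-extract Q? Q′? (suc a) Qa iff zero    ()
mulParts-extract {Q} {Q′} Q? Q′? a Qa iff (suc m) a≤m g n with suc m ≟ a
... | yes refl
  rewrite dec-true (Q? a) Qa
        | dec-false (Q′? a) (λ Q′a → proj₂ (Equivalence.to (iff a) Q′a) refl)
        | mulParts-ext {λ x → does (Q? x)} {λ x → does (Q′? x)} m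
            (λ x x≤m → does-⇔ (mk⇔ (λ Qx → Equivalence.from (iff x) (Qx , <⇒≢ (s≤s x≤m)))
                                    (λ Q′x → proj₁ (Equivalence.to (iff x) Q′x))) (Q? x) (Q′? x)) g
  = refl
... | no m≢a
  with ih ← mulParts-extract Q? Q′? a Qa iff m (≤-pred (≤∧≢⇒< a≤m (m≢a ∘ sym))) g
  rewrite does-⇔ (mk⇔ (λ Qx → Equivalence.from (iff (suc m)) (Qx , m≢a))
                      (λ Q′x → proj₁ (Equivalence.to (iff (suc m)) Q′x))) (Q? (suc m)) (Q′? (suc m))
  with does (Q′? (suc m))
...   | false = ih n
...   | true  = trans (geo-cong (suc m) ih n) (geo-comm (suc m) a _ n)

Without : Pred ℕ 0ℓ → ℕ → Pred ℕ 0ℓ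
Without Q a x = Q x × x ≢ a

without? : ∀ {Q} → Decidable Q → ∀ a → Decidable (Without Q a)
without? Q? a x = Q? x ×-dec ¬? (x ≟ a)

-- The two counts as series

module Counting (L s₀ k₀ : ℕ) where

  s = suc s₀
  k = suc k₀

  -- `Common` is the set A. For the `k` considered, `Source` adds `k` to it and `Target` adds `s`.
  Source Common Target : Pred ℕ 0ℓ
  Source x = suc s ≤ x × x ≤ s + L
  Common = Without Source k
  Target x = s ≤ x × x ≤ L + s × x ≢ k

  source? : Decidable Source
  source? x = (suc s ≤? x) ×-dec (x ≤? s + L)

  common? : Decidable Common
  common? = without? source? k

  target? : Decidable Target
  target? x = (s ≤? x) ×-dec (x ≤? L + s) ×-dec ¬? (x ≟ k)

  common : ℕ → Series
  common n = mulParts (λ x → does (common? x)) (s + L + n) one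

  c₂-count : Source k → ∀ n → c₂ L s n ≡ geo k (common n) n
  c₂-count Sk n = trans (countPartitions-all source? (s + L) n)
    (mulParts-extract source? common? k Sk (λ _ → mk⇔ id id) (s + L + n) (≤-trans (proj₂ Sk) (m≤m+n (s + L) n)) one n)

  target-without-s : ∀ x → Common x ⇔ (Target x × x ≢ s)
  target-without-s x = mk⇔
    (λ ((s<x , x≤) , x≢k) → (<⇒≤ s<x , ≤-trans x≤ (≤-reflexive (+-comm s L)) , x≢k) , >⇒≢ s<x)
    (λ ((s≤x , x≤ , x≢k) , x≢s) → (≤∧≢⇒< s≤x (x≢s ∘ sym) , ≤-trans x≤ (≤-reflexive (+-comm L s))) , x≢k)

  cover : ∀ {π} → All Target π → FProp L s k π ⊎ All Common π
  cover {π} all with Any.any? (_≟ s) π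
  ... | yes any = inj₁ ((any , All.map proj₁ all) , All.map (proj₁ ∘ proj₂) all ,
                        All¬⇒¬Any (All.map (proj₂ ∘ proj₂) all))
  ... | no ¬any = inj₂ (All.zipWith (λ {x} tx → Equivalence.from (target-without-s x) tx) (all , ¬Any⇒All¬ π ¬any))

  -- Partitions into `Target` parts either contain `s` and are counted by `f`, or have all parts in
  -- `Common`. Splitting off one copy of `s` by `geo-unfold` isolates the same second summand, which
  -- cancels.
  f-count : s ≢ k → ∀ n → shift s (geo s (common n)) n ≤ f L s k n
  f-count s≢k n = +-cancelˡ-≤ (common n n) _ _ (begin
    common n n + shift s (geo s (common n)) n
      ≡⟨ geo-unfold s (common n) n ⟨
    geo s (common n) n
      ≡⟨ mulParts-extract target? common? s (≤-refl , m≤n+m s L , s≢k) target-without-s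
           (s + L + n) (≤-trans (m≤m+n s L) (m≤m+n (s + L) n)) one n ⟨
    mulParts (λ x → does (target? x)) (s + L + n) one n
      ≡⟨ countPartitions-all target? (s + L) n ⟨
    countPartitions (All.all? target?) n
      ≤⟨ count-⊆-∪ (All.all? target?) (fProp? L s k) (All.all? common?) cover (partitions n) ⟩
    f L s k n + countPartitions (All.all? common?) n
      ≡⟨ cong (f L s k n +_) (countPartitions-all common? (s + L) n) ⟩
    f L s k n + common n n
      ≡⟨ +-comm (f L s k n) (common n n) ⟩
    common n n + f L s k n ∎)
    where open ≤-Reasoning

  module _ (p₀ u₀ : ℕ) where
    open TwoParts p₀ u₀

    rest? : Decidable (Without (Without Common p) (p + u))
    rest? = without? (without? common? p) (p + u)

    isRest : ℕ → Bool
    isRest x = does (rest? x)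

    rest : ℕ → Series → Series
    rest n = mulParts isRest (s + L + n)

    common-pair : Common p → Common (p + u) → ∀ n l → common n l ≡ rest n pair l
    common-pair Cp Cp+u n l = begin
      common n l
        ≡⟨ mulParts-extract common? (without? common? p) p Cp (λ _ → mk⇔ id id) (s + L + n) (within Cp) one l ⟩
      geo p (mulParts (λ x → does (without? common? p x)) (s + L + n) one) l
        ≡⟨ geo-cong p (mulParts-extract (without? common? p) rest? (p + u) (Cp+u , m+1+n≢m p) (λ _ → mk⇔ id id)
             (s + L + n) (within Cp+u) one) l ⟩
      geo p (geo (p + u) (rest n one)) l
        ≡⟨ geo-cong p (mulParts-geo isRest (s + L + n) (p + u) one) l ⟨
      geo p (rest n (geo (p + u) one)) l
        ≡⟨ mulParts-geo isRest (s + L + n) p (geo (p + u) one) l ⟨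
      rest n pair l ∎
      where
      open ≡-Reasoning
      within : ∀ {x} → Common x → x ≤ s + L + n
      within ((_ , x≤) , _) = ≤-trans x≤ (m≤m+n (s + L) n)

    -- Both counts share the factor `rest n`, which commutes with `geo` and `shift`; only the
    -- comparison of the two-part series under this factor remains.
    c₂≤f : Source k → Common p → Common (p + u) → ∀ n →
      rest n (geo k pair) n ≤ rest n (shift s (geo s pair)) n → c₂ L s n ≤ f L s k n
    c₂≤f Sk Cp Cp+u n dominated = begin
      c₂ L s n                            ≡⟨ c₂-count Sk n ⟩
      geo k (common n) n                  ≡⟨ geo-cong k (common-pair Cp Cp+u n) n ⟩
      geo k (rest n pair) n               ≡⟨ mulParts-geo isRest (s + L + n) k pair n ⟨
      rest n (geo k pair) n               ≤⟨ dominated ⟩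
      rest n (shift s (geo s pair)) n     ≡⟨ mulParts-shift isRest (s + L + n) s (geo s pair) n ⟩
      shift s (rest n (geo s pair)) n     ≡⟨ shift-cong s (mulParts-geo isRest (s + L + n) s pair) n ⟩
      shift s (geo s (rest n pair)) n     ≡⟨ shift-cong s (geo-cong s (common-pair Cp Cp+u n)) n ⟨
      shift s (geo s (common n)) n        ≤⟨ f-count (<⇒≢ (proj₁ Sk)) n ⟩
      f L s k n                           ∎
      where open ≤-Reasoning

-- Choice of the two parts

module Cases (s₀ : ℕ) where

  private
    s = suc s₀

  -- The excluded part is written as `s + 1 * suc e` to agree with the form `s + u * suc e` used in
  -- the matching with `u = 1`.
  offset-part : ∀ L e c → c < L → c ≢ e → Counting.Common L s₀ (s₀ + 1 * suc e) (suc c + s)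
  offset-part L e c c<L c≢e = (s≤s (m≤n+m s c) , ≤-trans (≤-reflexive (+-comm (suc c) s)) (+-monoʳ-≤ s c<L)) ,
    λ eq → c≢e (suc-injective (+-cancelʳ-≡ s (suc c) (suc e)
      (trans eq (trans (cong (s +_) (*-identityˡ (suc e))) (+-comm s (suc e))))))

  missing-part : ∀ L e → e < L → Counting.Source L s₀ (s₀ + 1 * suc e) (s + 1 * suc e)
  missing-part L e e<L = ≤-trans (≤-reflexive (+-comm 1 s)) (+-monoʳ-≤ s (s≤s z≤n)) ,
    +-monoʳ-≤ s (≤-trans (≤-reflexive (*-identityˡ (suc e))) e<L)

  consecutive : ∀ c → Σ ℕ λ M → ∀ L e → suc c < L → e < L → c ≢ e → suc c ≢ e →
    ∀ n → M ≤ n → c₂ L s n ≤ f L s (s + 1 * suc e) n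
  consecutive c = proj₁ adjoining-parts , λ L e c<L e<L c≢e sc≢e n M≤n →
    let open Counting L s₀ (s₀ + 1 * suc e) using (Common; isRest; c₂≤f) in
    c₂≤f (c + s) 0 (missing-part L e e<L) (offset-part L e c (<⇒≤ c<L) c≢e)
      (subst Common (+-comm 1 (suc c + s)) (offset-part L e (suc c) c<L sc≢e)) n
      (proj₂ adjoining-parts e (isRest (c + s) 0) (s + L + n) n M≤n)
    where
    open TwoParts (c + s) 0 using (module Matching)
    open Matching s₀ (leftover-consecutive (c + s) s) using (adjoining-parts)

  gap : Σ ℕ λ M → ∀ L → 3 ≤ L → ∀ n → M ≤ n → c₂ L s n ≤ f L s (s + 1 * 2) n
  gap = proj₁ adjoining-parts , λ L 3≤L n M≤n →
    let open Counting L s₀ (s₀ + 1 * 2) using (Common; isRest; c₂≤f) in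
    c₂≤f s 1 (missing-part L 1 (<⇒≤ 3≤L)) (offset-part L 1 0 (≤-trans (s≤s z≤n) 3≤L) (λ ()))
      (subst Common (+-comm 2 (suc s)) (offset-part L 1 2 3≤L (λ ()))) n
      -- Here `u = 2`, and `e = 0` gives `s + 2 * 1`, which computes to the same part as
      -- `s + 1 * 2`.
      (proj₂ adjoining-parts 0 (isRest s 1) (s + L + n) n M≤n)
    where
    open TwoParts s 1 using (module Matching)
    open Matching s₀ (leftover-gap s) using (adjoining-parts)

theorem1p1 : (s : ℕ) → 1 ≤ s →
    Σ ℕ (λ M → (L k : ℕ) → 3 ≤ L → (suc s ⊔ L) ≤ k → k ≤ s + L →
    (n : ℕ) → M ≤ n → c₂ L s n ≤ f L s k n)
theorem1p1 s@(suc s₀) _ = M₀ + M₁ + M₂ , result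
  where
  open Cases s₀
  M₀ = proj₁ (consecutive 0)
  M₁ = proj₁ (consecutive 1)
  M₂ = proj₁ gap

  -- With `k = s + 1 + e`, the pair is (s+2, s+3) for `e = 0`, (s+1, s+3) for `e = 1` and (s+1, s+2)
  -- otherwise; `3 ≤ L` keeps `s + 3` in range.
  by-offset : ∀ L e → 3 ≤ L → e < L → ∀ n → M₀ + M₁ + M₂ ≤ n → c₂ L s n ≤ f L s (s + 1 * suc e) n
  by-offset L 0 3≤L e<L n M≤n =
    proj₂ (consecutive 1) L 0 3≤L e<L (λ ()) (λ ()) n (m+n≤o⇒n≤o M₀ (m+n≤o⇒m≤o (M₀ + M₁) M≤n))
  by-offset L 1 3≤L e<L n M≤n = proj₂ gap L 3≤L n (m+n≤o⇒n≤o (M₀ + M₁) M≤n)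
  by-offset L (suc (suc e)) 3≤L e<L n M≤n =
    proj₂ (consecutive 0) L (suc (suc e)) (<⇒≤ 3≤L) e<L (λ ()) (λ ()) n (m+n≤o⇒m≤o M₀ (m+n≤o⇒m≤o (M₀ + M₁) M≤n))

  result : ∀ L k → 3 ≤ L → (suc s ⊔ L) ≤ k → k ≤ s + L → ∀ n → M₀ + M₁ + M₂ ≤ n → c₂ L s n ≤ f L s k n
  result L k 3≤L s⊔L≤k k≤s+L n M≤n with m≤n⇒∃[o]m+o≡n (m⊔n≤o⇒m≤o (suc s) L s⊔L≤k)
  ... | e , refl = subst (λ k → c₂ L s n ≤ f L s k n) (offset s e)
          (by-offset L e 3≤L (+-cancelˡ-≤ s (suc e) L (≤-trans (≤-reflexive (+-suc s e)) k≤s+L)) n M≤n)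
    where
    offset : ∀ s e → s + 1 * suc e ≡ suc s + e
    offset = solve-∀
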